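{- Let $G$ be a graph with $n$ vertices and maximum degree $\Delta$. Then \[\gamma_{ir}(G) \geq \max \left\{ \left \lceil \frac{n}{2} \right \rceil , \, n- \Delta \right\}.\] Moreover, the bound is sharp: there exist graphs for which equality holds.
   Context: All graphs are finite, simple, undirected and have at least one vertex. $N(v)$ denotes the set of neighbours of a vertex $v$. A dominating set of $G$ is a set $D \subseteq V(G)$ such that every vertex in $V(G)\setminus D$ has a neighbour in $D$. An irregular dominating set of $G$ is a dominating set $D$ of $G$ such that $|N(u) \cap D| \neq |N(v) \cap D|$ for every two distinct vertices $u, v \in V(G) \setminus D$ (in particular, $V(G)$ is one). The irregular domination number $\gamma_{ir}(G)$ is the size of a smallest irregular dominating set of $G$. -}

module Defs where

open import Data.Bool.Base using (true; false)
open import Data.Fin.Base using (Fin)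
open import Data.Fin.Properties using (all?; any?; _≟_)
open import Data.Fin.Subset using (Subset; Side; inside; outside; ⊤; _∈_; _∉_; _∩_; ∣_∣)
open import Data.Fin.Subset.Properties using (_∈?_; ∈⊤)
open import Data.List.Base using (List; []; _∷_; map; filter; allFin; cartesianProductWith)
import Data.List.Membership.Propositional as List
open import Data.List.Membership.Propositional.Properties
  using (∈-filter⁺; ∈-cartesianProductWith⁺)
open import Data.List.Extrema.Nat using (argmin; argmin-all; f[argmin]≤f[xs]; max)
import Data.List.Relation.Unary.All as All
open import Data.List.Relation.Unary.All.Properties using (all-filter)
open import Data.List.Relation.Unary.Any using (here; there)
open import Data.Nat.Base using (ℕ; _≤_; NonZero)
import Data.Nat.Properties as ℕ
open import Data.Product.Base using (∃-syntax; _×_; _,_)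
import Data.Vec.Base as Vec
open import Level using (0ℓ)
open import Relation.Binary.Core using (Rel)
open import Relation.Binary.Definitions using (Decidable; Irreflexive; Symmetric)
open import Relation.Binary.PropositionalEquality using (_≡_; _≢_; refl)
open import Relation.Nullary.Decidable using (Dec; does; ¬?; _×-dec_; _→-dec_)
open import Relation.Nullary.Negation using (contradiction)

record Graph : Set₁ where
  field
    order       : ℕ
    nonEmpty    : NonZero order
    Adj         : Rel (Fin order) 0ℓ
    adj?        : Decidable Adj
    adj-sym     : Symmetric Adj
    adj-irrefl  : Irreflexive _≡_ Adj

  Vertex : Set
  Vertex = Fin order

  N : Vertex → Subset order
  N v = Vec.tabulate λ u → does (adj? v u)

  degree : Vertex → ℕ
  degree v = ∣ N v ∣

  -- The default value 0 is harmless: there is at least one vertex.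
  Δ : ℕ
  Δ = max 0 (map degree (allFin order))

  Dominating : Subset order → Set
  Dominating D = ∀ v → v ∉ D → ∃[ u ] u ∈ D × u ∈ N v

  IrregularDominating : Subset order → Set
  IrregularDominating D =
    Dominating D ×
    (∀ u v → u ∉ D → v ∉ D → u ≢ v → ∣ N u ∩ D ∣ ≢ ∣ N v ∩ D ∣)

  irregularDominating? : ∀ D → Dec (IrregularDominating D)
  irregularDominating? D =
    all? (λ v → ¬? (v ∈? D) →-dec any? λ u → (u ∈? D) ×-dec (u ∈? N v))
    ×-dec
    all? λ u → all? λ v →
      ¬? (u ∈? D) →-dec ¬? (v ∈? D) →-dec ¬? (u ≟ v) →-dec
      ¬? (∣ N u ∩ D ∣ ℕ.≟ ∣ N v ∩ D ∣)

subsets : ∀ n → List (Subset n)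
subsets ℕ.zero    = Vec.[] ∷ []
subsets (ℕ.suc n) = cartesianProductWith Vec._∷_ (outside ∷ inside ∷ []) (subsets n)

∈-subsets : ∀ {n} (p : Subset n) → p List.∈ subsets n
∈-subsets Vec.[]      = here refl
∈-subsets (s Vec.∷ p) = ∈-cartesianProductWith⁺ Vec._∷_ (side s) (∈-subsets p)
  where
  side : (s : Side) → s List.∈ (outside ∷ inside ∷ [])
  side false = here refl
  side true  = there (here refl)

module _ (G : Graph) where
  open Graph G

  -- The default value ⊤ = V(G) is itself an irregular dominating set.
  smallestIrregularDominatingSet : Subset order
  smallestIrregularDominatingSet =
    argmin ∣_∣ ⊤ (filter irregularDominating? (subsets order))

  γir : ℕ
  γir = ∣ smallestIrregularDominatingSet ∣

  ⊤-irregularDominating : IrregularDominating ⊤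
  ⊤-irregularDominating =
    (λ v v∉⊤ → contradiction ∈⊤ v∉⊤) , λ u v u∉⊤ → contradiction ∈⊤ u∉⊤

  smallest-irregularDominating : IrregularDominating smallestIrregularDominatingSet
  smallest-irregularDominating =
    argmin-all ∣_∣ ⊤-irregularDominating (all-filter irregularDominating? (subsets order))

  γir-minimal : ∀ D → IrregularDominating D → γir ≤ ∣ D ∣
  γir-minimal D ird =
    All.lookup (f[argmin]≤f[xs] {f = ∣_∣} ⊤ (filter irregularDominating? (subsets order)))
               (∈-filter⁺ irregularDominating? (∈-subsets D) ird)

{-# OPTIONS --safe #-}

-- On the complement of an irregular dominating set D, the map u ↦ ∣ N u ∩ D ∣ is
-- injective, and it is positive because D dominates. Its values are bounded both by ∣ D ∣
-- and by Δ, so the pigeonhole principle gives n ∸ ∣ D ∣ ≤ ∣ D ∣ and n ∸ ∣ D ∣ ≤ Δ.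
-- Both bounds are attained by the complete graph on two vertices.
module Submission where

open import Defs
open import Data.Fin.Base using (Fin; zero; suc; fromℕ<)
open import Data.Fin.Properties
  using (fromℕ<-injective; injective⇒≤; suc-injective) renaming (_≟_ to _≟ꟳ_)
open import Data.Fin.Subset using (Subset; inside; outside; _∈_; _∉_; _∩_; ∁; ∣_∣)
open import Data.Fin.Subset.Properties
  using (x∈p⇒∣p-x∣<∣p∣; x∈∁p⇒x∉p; x∈p∩q⁺; ∣∁p∣≡n∸∣p∣; ∣p∩q∣≤∣p∣; ∣p∩q∣≤∣q∣)
open import Data.List.Base using (map; allFin)
open import Data.List.Membership.Propositional.Properties using (∈-allFin; ∈-map⁺)
import Data.List.Relation.Unary.All as All
open import Data.Nat.Base
  using (ℕ; _≤_; _<_; _≥_; _+_; _∸_; _⊔_; ⌈_/2⌉; pred; z≤n; NonZero; >-nonZero)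
open import Data.Nat.Properties
  using (≤-trans; ≤-reflexive; ≤-<-trans; +-comm; +-monoʳ-≤; m≤n+m∸n; m≤n+o⇒m∸n≤o;
         ≤-totalOrder; suc-pred; ⊔-lub; ⌈n/2⌉-mono; n≡⌈n+n/2⌉)
open import Data.List.Extrema ≤-totalOrder using (xs≤max)
open import Data.Product.Base using (_×_; ∃-syntax; _,_; proj₁; proj₂)
open import Data.Vec.Base using (_∷_; here; there)
open import Relation.Binary.PropositionalEquality
  using (_≡_; _≢_; refl; sym; trans; cong; subst; ≢-sym)
open import Relation.Nullary.Decidable using (¬?; decidable-stable)
open Graph using (order; Δ)

private
  variable
    n : ℕ

-- Deleting `x` strictly lowers the cardinality.
x∈p⇒0<∣p∣ : ∀ {x} {p : Subset n} → x ∈ p → 0 < ∣ p ∣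
x∈p⇒0<∣p∣ x∈p = ≤-<-trans z≤n (x∈p⇒∣p-x∣<∣p∣ x∈p)

-- Increasing enumeration of `p`; it carries questions about `∣ p ∣` over to maps out of
-- `Fin ∣ p ∣`.
element : (p : Subset n) → Fin ∣ p ∣ → Fin n
element (inside  ∷ p) zero    = zero
element (inside  ∷ p) (suc i) = suc (element p i)
element (outside ∷ p) i       = suc (element p i)

element-∈ : (p : Subset n) (i : Fin ∣ p ∣) → element p i ∈ p
element-∈ (inside  ∷ p) zero    = here
element-∈ (inside  ∷ p) (suc i) = there (element-∈ p i)
element-∈ (outside ∷ p) i       = there (element-∈ p i)

element-injective : (p : Subset n) {i j : Fin ∣ p ∣} → element p i ≡ element p j → i ≡ j
element-injective (inside  ∷ p) {zero}  {zero}  eq = refl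
element-injective (inside  ∷ p) {suc i} {suc j} eq =
  cong suc (element-injective p (suc-injective eq))
element-injective (outside ∷ p) eq = element-injective p (suc-injective eq)

-- Pigeonhole: `element p` followed by `f` is an injection from `Fin ∣ p ∣` to `Fin m`.
injectiveOn⇒∣p∣≤ : ∀ (p : Subset n) (f : Fin n → ℕ) {m} →
                   (∀ {x y} → x ∈ p → y ∈ p → f x ≡ f y → x ≡ y) →
                   (∀ {x} → x ∈ p → f x < m) →
                   ∣ p ∣ ≤ m
injectiveOn⇒∣p∣≤ p f inj f<m = injective⇒≤ λ {i} {j} eq →
  element-injective p (inj (element-∈ p i) (element-∈ p j)
    (fromℕ<-injective _ _ (f<m (element-∈ p i)) (f<m (element-∈ p j)) eq))

n≤m+m⇒⌈n/2⌉≤m : ∀ {m} → n ≤ m + m → ⌈ n /2⌉ ≤ m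
n≤m+m⇒⌈n/2⌉≤m {m = m} n≤m+m = ≤-trans (⌈n/2⌉-mono n≤m+m) (≤-reflexive (sym (n≡⌈n+n/2⌉ m)))

module _ (G : Graph) where
  open Graph G hiding (order; Δ)

  degree≤Δ : ∀ v → degree v ≤ Δ G
  degree≤Δ v = All.lookup (xs≤max 0 (map degree (allFin (order G)))) (∈-map⁺ degree (∈-allFin v))

  module _ {D : Subset (order G)} (ird : IrregularDominating D) where

    0<∣N∩D∣ : ∀ {v} → v ∉ D → 0 < ∣ N v ∩ D ∣
    0<∣N∩D∣ v∉D = let _ , u∈D , u∈Nv = proj₁ ird _ v∉D in x∈p⇒0<∣p∣ (x∈p∩q⁺ (u∈Nv , u∈D))

    ∣N∩D∣-injective : ∀ {u v} → u ∉ D → v ∉ D → ∣ N u ∩ D ∣ ≡ ∣ N v ∩ D ∣ → u ≡ v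
    ∣N∩D∣-injective {u} {v} u∉D v∉D eq =
      -- Irregularity only refutes `u ≢ v`; decidable equality of vertices removes the double
      -- negation.
      decidable-stable (u ≟ꟳ v) λ u≢v → proj₂ ird u v u∉D v∉D u≢v eq

    -- Common source of both bounds: the vertices outside `D` have distinct counts among 1, ...,
    -- `m`, so there are at most `m` of them.
    order≤∣D∣+bound : ∀ {m} → (∀ v → ∣ N v ∩ D ∣ ≤ m) → order G ≤ ∣ D ∣ + m
    order≤∣D∣+bound {m} bound =
      ≤-trans (m≤n+m∸n (order G) ∣ D ∣)
        (+-monoʳ-≤ ∣ D ∣ (subst (_≤ m) (∣∁p∣≡n∸∣p∣ D) ∣∁D∣≤m))
      where
      -- The shift by one moves the counts into 0, ..., `m` - 1; unshifted, they would only give `m`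
      -- + 1.
      f : Vertex → ℕ
      f v = pred ∣ N v ∩ D ∣

      suc-f : ∀ {v} → v ∈ ∁ D → ℕ.suc (f v) ≡ ∣ N v ∩ D ∣
      -- Domination makes the shift reversible, so `f` stays injective on `∁ D`.
      suc-f v∈∁D = suc-pred _ {{>-nonZero (0<∣N∩D∣ (x∈∁p⇒x∉p v∈∁D))}}

      ∣∁D∣≤m : ∣ ∁ D ∣ ≤ m
      ∣∁D∣≤m = injectiveOn⇒∣p∣≤ (∁ D) f
        (λ u∈∁D v∈∁D eq → ∣N∩D∣-injective (x∈∁p⇒x∉p u∈∁D) (x∈∁p⇒x∉p v∈∁D)
          (trans (sym (suc-f u∈∁D)) (trans (cong ℕ.suc eq) (suc-f v∈∁D))))
        (λ {v} v∈∁D → subst (_≤ m) (sym (suc-f v∈∁D)) (bound v))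

    irregularDominating-lowerBound : ⌈ order G /2⌉ ⊔ (order G ∸ Δ G) ≤ ∣ D ∣
    irregularDominating-lowerBound = ⊔-lub
      -- Here `m` is `∣ D ∣`; in the second component it is `Δ G`.
      (n≤m+m⇒⌈n/2⌉≤m (order≤∣D∣+bound λ v → ∣p∩q∣≤∣q∣ (N v) D))
      (m≤n+o⇒m∸n≤o (order G) (Δ G)
        (subst (order G ≤_) (+-comm ∣ D ∣ (Δ G))
          (order≤∣D∣+bound λ v → ≤-trans (∣p∩q∣≤∣p∣ (N v) D) (degree≤Δ v))))

complete : ∀ n → .{{NonZero n}} → Graph
complete n@(ℕ.suc _) = record
  { order      = n
  ; nonEmpty   = _
  ; Adj        = _≢_
  ; adj?       = λ u v → ¬? (u ≟ꟳ v)
  ; adj-sym    = ≢-sym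
  ; adj-irrefl = λ u≡v u≢v → u≢v u≡v
  }

theorem4p1 : (∀ (G : Graph) → γir G ≥ ⌈ order G /2⌉ ⊔ (order G ∸ Δ G)) ×
    (∃[ G ] γir G ≡ ⌈ order G /2⌉ ⊔ (order G ∸ Δ G))
theorem4p1 =
  (λ G → irregularDominating-lowerBound G (smallest-irregularDominating G)) ,
  -- Both sides evaluate to 1, the left one by searching the four subsets of the vertex set.
  (complete 2 , refl)
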